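{- Let $k \ge 2$ be an integer. If $G$ is a connected twin-free graph with $n$ vertices and $i_{\max}(G) = k$, then $n \le 2^{k-1}+k-2$. Furthermore, equality holds only if the graph $G$ is formed by taking a clique $K_{k-1}$ and adding, for every non-empty vertex subset $S$ of this clique, a vertex whose neighbourhood is precisely $S$.
   Context: $i_{\max}(G)$ denotes the number of maximal independent sets of $G$. A graph is twin-free if no two vertices have the same open neighbourhood. -}

module Defs where

open import Data.Empty using (⊥)
open import Data.Fin.Base using (Fin)
open import Data.Fin.Properties using (all?)
open import Data.Fin.Subset using (Subset; inside; outside; _∈_; _⊂_; Nonempty)
open import Data.Fin.Subset.Properties using (_∈?_; _⊂?_; anySubset?)
import Data.Fin.Properties as Fin
open import Data.List.Base using (List; []; _∷_; _++_; map; filter; length)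
open import Data.Nat.Base using (ℕ; zero; suc)
open import Data.Product.Base using (_×_; ∃)
open import Data.Refinement using (Refinement; value)
open import Data.Sum.Base using (_⊎_; inj₁; inj₂)
open import Data.Vec.Base using ([]; _∷_)
open import Function.Bundles using (_⇔_; _↔_; Inverse)
open import Relation.Binary.Construct.Closure.ReflexiveTransitive using (Star)
open import Relation.Binary.Definitions using (Decidable; Symmetric)
open import Relation.Binary.PropositionalEquality.Core using (_≢_; refl; sym)
open import Relation.Nullary.Decidable.Core using (Dec; no; _×-dec_; _→-dec_; ¬?)
open import Relation.Nullary.Negation.Core using (¬_)

-- Simple graphs. Adjacency is decidable so that the independent sets of a
-- finite graph can be counted.
record Graph (V : Set) : Set₁ where
  infix 4 _~_ _~?_
  field
    _~_      : V → V → Set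
    _~?_     : Decidable _~_
    ~-sym    : Symmetric _~_
    ~-irrefl : ∀ {v} → ¬ (v ~ v)

module _ {V : Set} (G : Graph V) where
  open Graph G

  Connected : Set
  Connected = ∀ u v → Star _~_ u v

  TwinFree : Set
  TwinFree = ∀ u v → u ≢ v → ¬ (∀ w → (u ~ w) ⇔ (v ~ w))

infix 4 _≅_
record _≅_ {V W : Set} (G : Graph V) (H : Graph W) : Set where
  field
    bijection : V ↔ W
  open Inverse bijection using (to)
  field
    adjacency : ∀ u v → Graph._~_ G u v ⇔ Graph._~_ H (to u) (to v)

-- Every subset of Fin n occurs exactly once in this list.
subsets : ∀ n → List (Subset n)
subsets zero    = [] ∷ []
subsets (suc n) = map (inside ∷_) (subsets n) ++ map (outside ∷_) (subsets n)

module _ {n : ℕ} (G : Graph (Fin n)) where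
  open Graph G

  Independent : Subset n → Set
  Independent S = ∀ u v → u ∈ S → v ∈ S → ¬ (u ~ v)

  MaximalIndependent : Subset n → Set
  MaximalIndependent S = Independent S × ¬ (∃ λ T → S ⊂ T × Independent T)

  independent? : ∀ S → Dec (Independent S)
  independent? S = all? λ u → all? λ v →
    (u ∈? S) →-dec ((v ∈? S) →-dec ¬? (u ~? v))

  maximalIndependent? : ∀ S → Dec (MaximalIndependent S)
  maximalIndependent? S =
    independent? S ×-dec ¬? (anySubset? λ T → (S ⊂? T) ×-dec independent? T)

  i-max : ℕ
  i-max = length (filter maximalIndependent? (subsets n))

-- The vertices of the clique K_m, together with one further vertex for each
-- non-empty subset S of the clique. `Refinement` makes the proof of
-- non-emptiness irrelevant; `Nonempty S` carries a chosen element, so a plain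
-- Σ-type would give |S| copies of the vertex for S.
ExtremalVertex : ℕ → Set
ExtremalVertex m = Fin m ⊎ Refinement (Subset m) Nonempty

extremal : ∀ m → Graph (ExtremalVertex m)
extremal m = record
  { _~_ = _~_ ; _~?_ = _~?_ ; ~-sym = λ {u} {v} → ~-sym u v
  ; ~-irrefl = λ {v} → ~-irrefl v }
  where
  _~_ : ExtremalVertex m → ExtremalVertex m → Set
  inj₁ i ~ inj₁ j = i ≢ j
  inj₁ i ~ inj₂ S = i ∈ value S
  inj₂ S ~ inj₁ j = j ∈ value S
  inj₂ _ ~ inj₂ _ = ⊥

  _~?_ : Decidable _~_
  inj₁ i ~? inj₁ j = ¬? (i Fin.≟ j)
  inj₁ i ~? inj₂ S = i ∈? value S
  inj₂ S ~? inj₁ j = j ∈? value S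
  inj₂ _ ~? inj₂ _ = no λ ()

  ~-sym : ∀ u v → u ~ v → v ~ u
  ~-sym (inj₁ _) (inj₁ _) i≢j = λ j≡i → i≢j (sym j≡i)
  ~-sym (inj₁ _) (inj₂ _) i∈S = i∈S
  ~-sym (inj₂ _) (inj₁ _) j∈S = j∈S

  ~-irrefl : ∀ v → ¬ (v ~ v)
  ~-irrefl (inj₁ _) i≢i = i≢i refl
  ~-irrefl (inj₂ _) ()

{-# OPTIONS --safe #-}
module Submission where

-- Send each vertex v to the set M v of maximal independent sets containing it.
-- Two vertices are adjacent iff their sets are disjoint, so twin-freeness makes
-- M injective; connectivity makes every M v proper, and since an independent
-- set extends to a maximal one, pairwise meeting sets M v have a common point.
-- Counting a family F of subsets of [k] with these properties together with
-- its complements gives 2n ≤ 2^k - 2 + d, where d counts the members whose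
-- complement also lies in F.
--
-- To see d ≤ 2(k - 1), take A minimal among these members. A point of A can be
-- traded for a point outside A lying in the same other members: replacing A by
-- its complement in the star of the point keeps it pairwise meeting. So deleting
-- A and its complement from F allows deleting the points of A from [k], and at
-- the end one point is left.
--
-- In the equality case each minimal A is a singleton, and S or its complement
-- lies in F for every S. Suppose A and its complement both lie in F and both
-- have at least two points. Let J be the set of points j with [k] - j in F, and
-- let S agree with J on A and with the complement of J off A. Either S or its
-- complement lies in F, contradicting the Helly property with A (or its
-- complement) and the sets [k] - j. Hence d = 2(k - 1) forces every point but
-- one, c, to be a singleton of F with complement in F, and the remaining members
-- of F are the proper subsets through c.

open import Defs
open import Data.Bool.Base using (true; false)
import Data.Bool.Properties as Bool
open import Data.Empty using () renaming (⊥ to Absurd)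
open import Data.Fin.Base using (Fin; zero; suc; punchIn; punchOut)
open import Data.Fin.Properties using (_≟_; all?; any?; ¬∀⟶∃¬; punchInᵢ≢i; punchIn-injective; punchIn-punchOut)
open import Data.Fin.Subset
open import Data.Fin.Subset.Induction using (⊂-wellFounded; ⊃-wellFounded; Acc; acc)
open import Data.Fin.Subset.Properties
open import Data.Irrelevant using ([_])
open import Data.List.Base using (List; []; _∷_; _++_; map; filter; length; allFin)
import Data.List.Base as List
open import Data.List.Membership.Propositional using () renaming (_∈_ to _∈ˡ_; _∉_ to _∉ˡ_)
open import Data.List.Membership.Propositional.Properties
  using (∈-∃++; ∈-++⁺ˡ; ∈-++⁺ʳ; ∈-++⁻; ∈-map⁺; ∈-map⁻; ∈-filter⁺; ∈-filter⁻; ∈-allFin; ∈-lookup)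
open import Data.List.Properties using (length-++; length-map; length-tabulate; filter-notAll)
open import Data.List.Relation.Unary.All using ([]; _∷_)
open import Data.List.Relation.Unary.All.Properties using (All¬⇒¬Any; ¬Any⇒All¬)
import Data.List.Relation.Unary.Any as Any
open import Data.List.Relation.Unary.Any using (here; there)
open import Data.List.Relation.Unary.Any.Properties using (lookup-index)
open import Data.List.Relation.Unary.AllPairs using ([]; _∷_)
open import Data.List.Relation.Unary.Unique.Propositional using (Unique)
import Data.List.Relation.Unary.Unique.Propositional.Properties as Unique
open import Data.Nat.Base using (ℕ; zero; suc; _+_; _*_; _∸_; _^_; _≤_; _<_; z≤n; s≤s)
import Data.Nat.Properties as ℕ
open import Data.Nat.Solver using (module +-*-Solver)
open import Data.Product.Base using (_×_; _,_; ∃; proj₁; proj₂)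
open import Data.Refinement using (value; value-injective) renaming (_,_ to _!_)
open import Data.Sum.Base using (_⊎_; inj₁; inj₂)
open import Data.Vec.Base using ([]; _∷_; tabulate; lookup; insertAt; removeAt)
open import Data.Vec.Properties
  using (≡-dec; lookup∘tabulate; []=⇒lookup; lookup⇒[]=; insertAt-lookup; insertAt-punchIn; removeAt-punchOut;
         removeAt-insertAt; insertAt-removeAt)
open import Function.Base using (_∘_; case_of_)
open import Function.Bundles using (_⇔_; mk⇔; mk↔ₛ′; Equivalence)
open import Relation.Binary.Construct.Closure.ReflexiveTransitive using (Star; ε; _◅_)
open import Relation.Binary.Definitions using (DecidableEquality)
open import Relation.Binary.PropositionalEquality using (_≡_; _≢_; refl; sym; trans; cong; cong₂; subst; module ≡-Reasoning)
open import Relation.Nullary.Decidable using (yes; no; does; _×-dec_; _⊎-dec_; ¬?; decidable-stable; recompute)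
open import Relation.Nullary.Negation using (¬_; contradiction)
open import Relation.Unary using (Decidable)

-- Counting with lists free of repetition.

module _ {A : Set} where

  ∉⇒Unique-∷ : ∀ {x : A} {xs} → x ∉ˡ xs → Unique xs → Unique (x ∷ xs)
  ∉⇒Unique-∷ x∉xs xs! = ¬Any⇒All¬ _ x∉xs ∷ xs!

  Unique-⊆⇒length-≤ : ∀ {xs ys : List A} → Unique xs →
                      (∀ {x} → x ∈ˡ xs → x ∈ˡ ys) → length xs ≤ length ys
  Unique-⊆⇒length-≤ {[]} _ _ = z≤n
  Unique-⊆⇒length-≤ {x ∷ xs} (x∉xs ∷ xs!) xs⊆ys
    with as , bs , refl ← ∈-∃++ (xs⊆ys (here refl)) = begin
      suc (length xs)              ≤⟨ s≤s (Unique-⊆⇒length-≤ xs! drop-x) ⟩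
      suc (length (as ++ bs))      ≡⟨ cong suc (length-++ as) ⟩
      suc (length as + length bs)  ≡⟨ ℕ.+-suc (length as) (length bs) ⟨
      length as + length (x ∷ bs)  ≡⟨ length-++ as ⟨
      length (as ++ x ∷ bs)        ∎
    where
    open ℕ.≤-Reasoning
    drop-x : ∀ {z} → z ∈ˡ xs → z ∈ˡ as ++ bs
    drop-x z∈xs with ∈-++⁻ as (xs⊆ys (there z∈xs))
    ... | inj₁ z∈as         = ∈-++⁺ˡ z∈as
    ... | inj₂ (here refl)  = contradiction z∈xs (All¬⇒¬Any x∉xs)
    ... | inj₂ (there z∈bs) = ∈-++⁺ʳ as z∈bs

  -- A missing `y` could be put in front of `xs`, giving a repetition-free list inside `ys` that is
  -- longer than `ys`.
  Unique-⊆-length⇒⊇ : DecidableEquality A → ∀ {xs ys : List A} → Unique xs →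
                      (∀ {x} → x ∈ˡ xs → x ∈ˡ ys) → length ys ≤ length xs →
                      ∀ {y} → y ∈ˡ ys → y ∈ˡ xs
  Unique-⊆-length⇒⊇ eq? {xs} xs! xs⊆ys ys≤xs {y} y∈ys with Any.any? (eq? y) xs
  ... | yes y∈xs = y∈xs
  ... | no  y∉xs = contradiction (Unique-⊆⇒length-≤ (∉⇒Unique-∷ y∉xs xs!) y∷xs⊆ys) (ℕ.≤⇒≯ ys≤xs)
    where
    y∷xs⊆ys : ∀ {x} → x ∈ˡ y ∷ xs → x ∈ˡ _
    y∷xs⊆ys (here refl)  = y∈ys
    y∷xs⊆ys (there x∈xs) = xs⊆ys x∈xs

  length-filter-¬ : ∀ {P : A → Set} (P? : Decidable P) xs →
                    length (filter P? xs) + length (filter (¬? ∘ P?) xs) ≡ length xs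
  length-filter-¬ P? [] = refl
  length-filter-¬ P? (x ∷ xs) with P? x
  ... | yes _ = cong suc (length-filter-¬ P? xs)
  ... | no  _ = trans (ℕ.+-suc _ _) (cong suc (length-filter-¬ P? xs))

-- Subsets of a finite set and their complements.

module _ {k : ℕ} where

  infix 4 _≟ˢ_
  _≟ˢ_ : DecidableEquality (Subset k)
  _≟ˢ_ = ≡-dec Bool._≟_

  ∈-elim : ∀ {S T : Subset k} {x} → S ≡ T → x ∈ S → x ∈ T
  ∈-elim refl x∈S = x∈S

  module _ {P : Fin k → Set} (P? : Decidable P) where

    ⟪_⟫ : Subset k
    ⟪_⟫ = tabulate (does ∘ P?)

    ∈⟪⟫⁺ : ∀ {x} → P x → x ∈ ⟪_⟫
    ∈⟪⟫⁺ {x} px = lookup⇒[]= x _ (trans (lookup∘tabulate (does ∘ P?) x) eq)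
      where
      eq : does (P? x) ≡ true
      eq with P? x
      ... | yes _  = refl
      ... | no ¬px = contradiction px ¬px

    ∈⟪⟫⁻ : ∀ {x} → x ∈ ⟪_⟫ → P x
    ∈⟪⟫⁻ {x} x∈ with P? x | trans (sym (lookup∘tabulate (does ∘ P?) x)) ([]=⇒lookup x∈)
    ... | yes px | _ = px

  ⁅⁆-injective : ∀ {i j : Fin k} → ⁅ i ⁆ ≡ ⁅ j ⁆ → i ≡ j
  ⁅⁆-injective {i} {j} eq = x∈⁅y⁆⇒x≡y j (∈-elim eq (x∈⁅x⁆ i))

  ≢⇒∈∁⁅⁆ : ∀ {i j : Fin k} → i ≢ j → i ∈ ∁ ⁅ j ⁆
  ≢⇒∈∁⁅⁆ = x∉p⇒x∈∁p ∘ x≢y⇒x∉⁅y⁆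

  ∈⇒≢⊥ : ∀ {S : Subset k} {x} → x ∈ S → S ≢ ⊥
  ∈⇒≢⊥ x∈S refl = ∉⊥ x∈S

  ∉⇒≢⊤ : ∀ {S : Subset k} {x} → x ∉ S → S ≢ ⊤
  ∉⇒≢⊤ x∉S refl = x∉S ∈⊤

∁-involutive : ∀ {k} (S : Subset k) → ∁ (∁ S) ≡ S
∁-involutive []      = refl
∁-involutive (b ∷ S) with b
... | true  = cong (true ∷_) (∁-involutive S)
... | false = cong (false ∷_) (∁-involutive S)

∁-injective : ∀ {k} {S T : Subset k} → ∁ S ≡ ∁ T → S ≡ T
∁-injective {S = S} {T} eq = trans (sym (∁-involutive S)) (trans (cong ∁ eq) (∁-involutive T))

∈-subsets : ∀ {k} (S : Subset k) → S ∈ˡ subsets k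
∈-subsets []             = here refl
∈-subsets (inside ∷ S)   = ∈-++⁺ˡ (∈-map⁺ (inside ∷_) (∈-subsets S))
∈-subsets {suc k} (outside ∷ S) = ∈-++⁺ʳ (map (inside ∷_) (subsets k)) (∈-map⁺ (outside ∷_) (∈-subsets S))

length-subsets : ∀ k → length (subsets k) ≡ 2 ^ k
length-subsets zero    = refl
length-subsets (suc k) = begin
  length (subsets (suc k))                          ≡⟨ length-++ (map (inside ∷_) (subsets k)) ⟩
  length (map (inside ∷_) (subsets k)) +
    length (map (outside ∷_) (subsets k))           ≡⟨ cong₂ _+_ (length-map _ (subsets k)) (length-map _ (subsets k)) ⟩
  length (subsets k) + length (subsets k)           ≡⟨ cong₂ _+_ (length-subsets k) (trans (length-subsets k) (sym (ℕ.+-identityʳ _))) ⟩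
  2 ^ suc k                                         ∎
  where open ≡-Reasoning

-- Families of sets with the Helly property.

-- A point stands for a maximal independent set and `M v` for those through `v`. Adjacency is then
-- disjointness, a pairwise meeting subfamily is an independent set, and its common point is a
-- maximal independent set containing it.
record HellyFamily {n k : ℕ} (M : Fin n → Subset k) : Set₁ where
  field
    injective : ∀ {u v} → M u ≡ M v → u ≡ v
    nonempty  : ∀ v → Nonempty (M v)
    proper    : ∀ v → ∃ λ i → i ∉ M v
    helly     : ∀ {P : Fin n → Set} → Decidable P →
                (∀ u v → P u → P v → ∃ λ i → i ∈ M u × i ∈ M v) →
                ∃ λ i → ∀ v → P v → i ∈ M v

module HellyFamilyProperties {n m : ℕ} {M : Fin n → Subset (suc m)} (hf : HellyFamily M) where
  open HellyFamily hf

  Member : Subset (suc m) → Set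
  Member S = ∃ λ v → M v ≡ S

  member? : Decidable Member
  member? S = any? λ v → M v ≟ˢ S

  -- Complementary pairs and the bound on their number.

  Opposite : Fin n → Fin n → Set
  Opposite v w = M w ≡ ∁ (M v)

  module _ {v w} (opp : Opposite v w) where

    opposite-sym : Opposite w v
    opposite-sym = trans (sym (∁-involutive (M v))) (cong ∁ (sym opp))

    ∉⇒∈-opposite : ∀ {i} → i ∉ M v → i ∈ M w
    ∉⇒∈-opposite = ∈-elim (sym opp) ∘ x∉p⇒x∈∁p

    ∈-opposite⇒∉ : ∀ {i} → i ∈ M w → i ∉ M v
    ∈-opposite⇒∉ = x∈∁p⇒x∉p ∘ ∈-elim opp

    opposite-irrefl : v ≢ w
    opposite-irrefl refl with i , i∈ ← nonempty v = ∈-opposite⇒∉ i∈ i∈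

  opposite-unique : ∀ {v w w′} → Opposite v w → Opposite v w′ → w ≡ w′
  opposite-unique o o′ = injective (trans o (sym o′))

  Closed : List (Fin n) → Set
  Closed D = ∀ {v} → v ∈ˡ D → ∃ λ w → w ∈ˡ D × Opposite v w

  Minimal : List (Fin n) → Fin n → Set
  Minimal D v = ∀ {w} → w ∈ˡ D → M w ⊆ M v → w ≡ v

  minimal-below : ∀ D {v} → v ∈ˡ D → ∃ λ u → u ∈ˡ D × M u ⊆ M v × Minimal D u
  minimal-below D {v} v∈D = go v v∈D (⊂-wellFounded (M v))
    where
    go : ∀ v → v ∈ˡ D → Acc _⊂_ (M v) → ∃ λ u → u ∈ˡ D × M u ⊆ M v × Minimal D u
    go v v∈D (acc rec) with any? (λ w → Any.any? (w ≟_) D ×-dec (M w ⊂? M v))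
    ... | yes (w , w∈D , w⊂v) with u , u∈D , u⊆w , u-min ← go w w∈D (rec w⊂v) =
      u , u∈D , proj₁ w⊂v ∘ u⊆w , u-min
    ... | no ∄w = v , v∈D , (λ x → x) , v-min
      where
      v-min : Minimal D v
      v-min {w} w∈D w⊆v with any? (λ i → (i ∈? M v) ×-dec ¬? (i ∈? M w))
      ... | yes (i , i∈v , i∉w) = contradiction (w , w∈D , (λ {x} → w⊆v {x}) , i , i∈v , i∉w) ∄w
      ... | no ∄i = injective (⊆-antisym w⊆v λ {i} i∈v →
              decidable-stable (i ∈? M w) λ i∉w → ∄i (i , i∈v , i∉w))

  -- Apply `helly` to `v̄` and the members of `D` through `i` other than `v`. A member disjoint from
  -- `M v̄` would lie inside `M v`, against minimality, so these meet pairwise. The common point `j`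
  -- is outside `M v`; if `j` lies in `M w` but `i` does not, then the complement of `M w` contains
  -- `i`, hence `j`, which is absurd.
  flip-minimal : ∀ {D v v̄} → Closed D → v ∈ˡ D → Opposite v v̄ → Minimal D v →
                 ∀ {i} → i ∈ M v →
                 ∃ λ j → j ∉ M v × (∀ {w} → w ∈ˡ D → w ≢ v → w ≢ v̄ → i ∈ M w ⇔ j ∈ M w)
  flip-minimal {D} {v} {v̄} closed v∈D opp v-min {i} i∈v = case helly P? meet of λ where
      (j , j∈) → j , ∈-opposite⇒∉ opp (j∈ v̄ (inj₁ refl)) , λ {w} w∈D w≢v w≢v̄ →
        mk⇔ (λ i∈w → j∈ w (inj₂ (w∈D , i∈w , w≢v)))
            (λ j∈w → decidable-stable (i ∈? M w) λ i∉w →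
               let w̄ , w̄∈D , oppw = closed w∈D
                   w̄≢v = λ where refl → w≢v̄ (opposite-unique (opposite-sym oppw) opp)
               in ∈-opposite⇒∉ oppw (j∈ w̄ (inj₂ (w̄∈D , ∉⇒∈-opposite oppw i∉w , w̄≢v))) j∈w)
    where
    P : Fin n → Set
    P w = w ≡ v̄ ⊎ (w ∈ˡ D × i ∈ M w × w ≢ v)

    P? : Decidable P
    P? w = (w ≟ v̄) ⊎-dec (Any.any? (w ≟_) D ×-dec ((i ∈? M w) ×-dec ¬? (w ≟ v)))

    meet-v̄ : ∀ {w} → w ∈ˡ D → w ≢ v → ∃ λ x → x ∈ M w × x ∈ M v̄
    meet-v̄ {w} w∈D w≢v with any? (λ x → (x ∈? M w) ×-dec (x ∈? M v̄))
    ... | yes x∈ = x∈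
    ... | no ∄x  = contradiction (v-min w∈D λ {x} x∈w →
            decidable-stable (x ∈? M v) λ x∉v → ∄x (x , x∈w , ∉⇒∈-opposite opp x∉v)) w≢v

    meet : ∀ u w → P u → P w → ∃ λ x → x ∈ M u × x ∈ M w
    meet u w (inj₁ refl) (inj₁ refl) with x , x∈ ← nonempty v̄ = x , x∈ , x∈
    meet u w (inj₁ refl) (inj₂ (w∈D , _ , w≢v)) with x , x∈w , x∈v̄ ← meet-v̄ w∈D w≢v = x , x∈v̄ , x∈w
    meet u w (inj₂ (u∈D , _ , u≢v)) (inj₁ refl) = meet-v̄ u∈D u≢v
    meet u w (inj₂ (_ , i∈u , _)) (inj₂ (_ , i∈w , _)) = i , i∈u , i∈w

  -- `Y` holds a representative of every class of points that `D` does not separate.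
  Covers : List (Fin n) → List (Fin (suc m)) → Set
  Covers D Y = ∀ i → ∃ λ y → y ∈ˡ Y × (∀ {w} → w ∈ˡ D → i ∈ M w ⇔ y ∈ M w)

  module Removal {D v v̄} (closed : Closed D) (v∈D : v ∈ˡ D) (opp : Opposite v v̄) where

    kept? : Decidable λ w → w ≢ v × w ≢ v̄
    kept? w = ¬? (w ≟ v) ×-dec ¬? (w ≟ v̄)

    D⁻ : List (Fin n)
    D⁻ = filter kept? D

    D⁻-closed : Closed D⁻
    D⁻-closed w∈ with w∈D , w≢v , w≢v̄ ← ∈-filter⁻ kept? {xs = D} w∈ with w̄ , w̄∈D , oppw ← closed w∈D =
      w̄ , ∈-filter⁺ kept? w̄∈D
            ( (λ where refl → w≢v̄ (opposite-unique (opposite-sym oppw) opp))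
            , (λ where refl → w≢v (opposite-unique (opposite-sym oppw) (opposite-sym opp))))
        , oppw

    length-D≤ : Unique D → length D ≤ 2 + length D⁻
    length-D≤ D! = Unique-⊆⇒length-≤ D! λ {w} w∈D → case w ≟ v of λ where
      (yes refl) → here refl
      (no w≢v) → case w ≟ v̄ of λ where
        (yes refl) → there (here refl)
        (no w≢v̄)  → there (there (∈-filter⁺ kept? w∈D (w≢v , w≢v̄)))

    off? : Decidable λ y → y ∉ M v
    off? y = ¬? (y ∈? M v)

    -- If the representative `y` of `i` lies in `M v`, `flip-minimal` trades it for some `j` outside
    -- `M v`. The representative `z` of `j` is outside `M v` too, because `v` itself belongs to `D`.
    covers⁻ : Minimal D v → ∀ {Y} → Covers D Y → Covers D⁻ (filter off? Y)
    covers⁻ v-min {Y} cov i with y , y∈Y , i~y ← cov i with y ∈? M v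
    ... | no y∉v = y , ∈-filter⁺ off? y∈Y y∉v , λ w∈ → i~y (proj₁ (∈-filter⁻ kept? w∈))
    ... | yes y∈v
      with j , j∉v , y~j ← flip-minimal closed v∈D opp v-min y∈v
      with z , z∈Y , j~z ← cov j =
        z , ∈-filter⁺ off? z∈Y (j∉v ∘ Equivalence.from (j~z v∈D))
          , λ w∈ → let w∈D , w≢v , w≢v̄ = ∈-filter⁻ kept? {xs = D} w∈ in
              mk⇔ (Equivalence.to (j~z w∈D) ∘ Equivalence.to (y~j w∈D w≢v w≢v̄) ∘ Equivalence.to (i~y w∈D))
                  (Equivalence.from (i~y w∈D) ∘ Equivalence.from (y~j w∈D w≢v w≢v̄) ∘ Equivalence.from (j~z w∈D))

    -- Since `v` is in `D`, a point of `M v` has its representative in `M v`, and that one is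
    -- deleted.
    length-off< : ∀ {Y} → Covers D Y → length (filter off? Y) < length Y
    length-off< {Y} cov with i , i∈v ← nonempty v with y , y∈Y , i~y ← cov i =
      filter-notAll off? Y (Any.map (λ where refl y∉v → y∉v (Equivalence.to (i~y v∈D) i∈v)) y∈Y)

  -- Each round removes a minimal member and its complement from `D`, and at least one point from
  -- `Y`. Once `D` is empty a point is still left in `Y`, which accounts for the 2 on the left.
  2+length≤2*cover : ∀ D Y → Unique D → Closed D → Covers D Y → 2 + length D ≤ 2 * length Y
  2+length≤2*cover D Y = go (length Y) D Y ℕ.≤-refl
    where
    go : ∀ N D Y → length Y ≤ N → Unique D → Closed D → Covers D Y → 2 + length D ≤ 2 * length Y
    go N D [] _ _ _ cov = case proj₁ (proj₂ (cov zero)) of λ ()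
    go (suc N) [] (y ∷ Y) _ _ _ _ = ℕ.*-monoʳ-≤ 2 (s≤s (z≤n {length Y}))
    go (suc N) D@(_ ∷ _) Y@(_ ∷ _) Y≤N D! closed cov
      with v , v∈D , _ , v-min ← minimal-below D (here refl)
      with v̄ , _ , opp ← closed v∈D = begin
        2 + length D                       ≤⟨ ℕ.+-monoʳ-≤ 2 (length-D≤ D!) ⟩
        2 + (2 + length D⁻)                ≤⟨ ℕ.+-monoʳ-≤ 2 (go N D⁻ (filter off? Y) (ℕ.≤-pred (ℕ.≤-trans (length-off< cov) Y≤N))
                                                (Unique.filter⁺ kept? D!) D⁻-closed (covers⁻ v-min cov)) ⟩
        2 + 2 * length (filter off? Y)     ≡⟨ ℕ.*-suc 2 _ ⟨
        2 * suc (length (filter off? Y))   ≤⟨ ℕ.*-monoʳ-≤ 2 (length-off< cov) ⟩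
        2 * length Y                       ∎
      where
      open ℕ.≤-Reasoning
      open Removal closed v∈D opp

  -- Counting the members together with their complements.

  Double : Fin n → Set
  Double v = Member (∁ (M v))

  double? : Decidable Double
  double? v = member? (∁ (M v))

  doubles unpaired : List (Fin n)
  doubles = filter double? (allFin n)
  unpaired = filter (¬? ∘ double?) (allFin n)

  ∈-doubles : ∀ {v} → Double v → v ∈ˡ doubles
  ∈-doubles = ∈-filter⁺ double? (∈-allFin _)

  doubles-unique : Unique doubles
  doubles-unique = Unique.filter⁺ double? (Unique.allFin⁺ n)

  doubles-closed : Closed doubles
  doubles-closed {v} v∈ with w , opp ← proj₂ (∈-filter⁻ double? {xs = allFin n} v∈) =
    w , ∈-doubles (v , opposite-sym opp) , opp

  allFin-covers : ∀ D → Covers D (allFin (suc m))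
  allFin-covers D i = i , ∈-allFin i , λ _ → mk⇔ (λ x → x) (λ x → x)

  length-allFin : ∀ k → length (allFin k) ≡ k
  length-allFin k = length-tabulate (λ (x : Fin k) → x)

  doubles-bound : 2 + length doubles ≤ 2 * suc m
  doubles-bound = subst (λ k → 2 + length doubles ≤ 2 * k) (length-allFin (suc m))
    (2+length≤2*cover doubles _ doubles-unique doubles-closed (allFin-covers doubles))

  -- Only unpaired members contribute complements, since the complement of a double is already
  -- listed as a member.
  hit : List (Subset (suc m))
  hit = ⊥ ∷ ⊤ ∷ map M (allFin n) ++ map (∁ ∘ M) unpaired

  M≢⊥ : ∀ v → M v ≢ ⊥
  M≢⊥ v = ∈⇒≢⊥ (proj₂ (nonempty v))

  M≢⊤ : ∀ v → M v ≢ ⊤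
  M≢⊤ v = ∉⇒≢⊤ (proj₂ (proper v))

  ∈-hit-tail : ∀ {S} → S ∈ˡ map M (allFin n) ++ map (∁ ∘ M) unpaired → ∃ λ v → M v ≡ S ⊎ ∁ (M v) ≡ S
  ∈-hit-tail S∈ with ∈-++⁻ (map M (allFin n)) S∈
  ... | inj₁ S∈ with v , _ , eq ← ∈-map⁻ M S∈       = v , inj₁ (sym eq)
  ... | inj₂ S∈ with v , _ , eq ← ∈-map⁻ (∁ ∘ M) S∈ = v , inj₂ (sym eq)

  hit-unique : Unique hit
  hit-unique = ∉⇒Unique-∷ ⊥∉ (∉⇒Unique-∷ ⊤∉
      (Unique.++⁺ (Unique.map⁺ injective (Unique.allFin⁺ n))
                  (Unique.map⁺ (injective ∘ ∁-injective) (Unique.filter⁺ (¬? ∘ double?) (Unique.allFin⁺ n)))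
                  disjoint))
    where
    ⊤∉ : ⊤ ∉ˡ map M (allFin n) ++ map (∁ ∘ M) unpaired
    ⊤∉ S∈ with v , S≡ ← ∈-hit-tail S∈ with S≡
    ... | inj₁ eq = M≢⊤ v eq
    ... | inj₂ eq with i , i∈ ← nonempty v = x∈p⇒x∉∁p i∈ (∈-elim (sym eq) ∈⊤)

    ⊥∉ : ⊥ ∉ˡ ⊤ ∷ map M (allFin n) ++ map (∁ ∘ M) unpaired
    ⊥∉ (here ())
    ⊥∉ (there S∈) with v , S≡ ← ∈-hit-tail S∈ with S≡
    ... | inj₁ eq = M≢⊥ v eq
    ... | inj₂ eq with i , i∉ ← proper v = ∉⊥ (∈-elim eq (x∉p⇒x∈∁p i∉))

    disjoint : ∀ {S} → ¬ (S ∈ˡ map M (allFin n) × S ∈ˡ map (∁ ∘ M) unpaired)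
    disjoint (S∈₁ , S∈₂)
      with w , _ , eq₁ ← ∈-map⁻ M S∈₁ with v , v∈ , eq₂ ← ∈-map⁻ (∁ ∘ M) S∈₂ =
        proj₂ (∈-filter⁻ (¬? ∘ double?) {xs = allFin n} v∈) (w , trans (sym eq₁) eq₂)

  length-hit : length hit ≡ 2 + (n + length unpaired)
  length-hit = cong (2 +_) (trans (length-++ (map M (allFin n)))
    (trans (cong (_+ length (map (∁ ∘ M) unpaired)) (trans (length-map M (allFin n)) (length-allFin n)))
           (cong (n +_) (length-map (∁ ∘ M) unpaired))))

  hit-bound : length hit ≤ 2 ^ suc m
  hit-bound = subst (length hit ≤_) (length-subsets (suc m))
    (Unique-⊆⇒length-≤ hit-unique λ {S} _ → ∈-subsets S)

  doubles+unpaired : length doubles + length unpaired ≡ n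
  doubles+unpaired = trans (length-filter-¬ double? (allFin n)) (length-allFin n)

  -- The 2 added to the doubles matches `doubles-bound`, so that the two upper bounds can be summed
  -- and halved.
  hit+doubles : length hit + (2 + length doubles) ≡ 2 * (n + 2)
  hit+doubles = begin
    length hit + (2 + length doubles)                     ≡⟨ cong (_+ (2 + length doubles)) length-hit ⟩
    2 + (n + length unpaired) + (2 + length doubles)       ≡⟨ shuffle n (length unpaired) (length doubles) ⟩
    4 + n + (length doubles + length unpaired)             ≡⟨ cong (4 + n +_) doubles+unpaired ⟩
    4 + n + n                                             ≡⟨ double n ⟩
    2 * (n + 2)                                           ∎
    where
    open ≡-Reasoning
    open +-*-Solver
    shuffle : ∀ a b c → 2 + (a + b) + (2 + c) ≡ 4 + a + (c + b)
    shuffle = solve 3 (λ a b c → con 2 :+ (a :+ b) :+ (con 2 :+ c) := con 4 :+ a :+ (c :+ b)) refl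
    double : ∀ a → 4 + a + a ≡ 2 * (a + 2)
    double = solve 1 (λ a → con 4 :+ a :+ a := con 2 :* (a :+ con 2)) refl

  n+2≤ : n + 2 ≤ 2 ^ m + suc m
  n+2≤ = ℕ.*-cancelˡ-≤ 2 (begin
    2 * (n + 2)                        ≡⟨ hit+doubles ⟨
    length hit + (2 + length doubles)  ≤⟨ ℕ.+-mono-≤ hit-bound doubles-bound ⟩
    2 * 2 ^ m + 2 * suc m              ≡⟨ ℕ.*-distribˡ-+ 2 (2 ^ m) (suc m) ⟨
    2 * (2 ^ m + suc m)                ∎)
    where open ℕ.≤-Reasoning

  -- The equality case.

  -- The family of the extremal graph: singletons off the centre `c` are the clique vertices, and
  -- proper subsets through `c` are the further vertices.
  record StarShaped (c : Fin (suc m)) : Set where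
    field
      leaf     : ∀ {i} → i ≢ c → Member ⁅ i ⁆
      through  : ∀ {S z} → c ∈ S → z ∉ S → Member S
      avoiding : ∀ {v} → c ∉ M v → ∃ λ i → i ≢ c × M v ≡ ⁅ i ⁆

  module Extremal (n+2≡ : n + 2 ≡ 2 ^ m + suc m) where

    total : length hit + (2 + length doubles) ≡ 2 ^ suc m + 2 * suc m
    total = trans hit+doubles (trans (cong (2 *_) n+2≡) (ℕ.*-distribˡ-+ 2 (2 ^ m) (suc m)))

    -- The bounds on `hit` and on the doubles add up to exactly `total`, so each of them is
    -- attained.
    hit-full : 2 ^ suc m ≤ length hit
    hit-full = ℕ.+-cancelʳ-≤ (2 * suc m) _ _
      (subst (_≤ length hit + 2 * suc m) total (ℕ.+-monoʳ-≤ (length hit) doubles-bound))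

    doubles-full : 2 * suc m ≤ 2 + length doubles
    doubles-full = ℕ.+-cancelˡ-≤ (2 ^ suc m) _ _
      (subst (_≤ 2 ^ suc m + (2 + length doubles)) total (ℕ.+-monoˡ-≤ (2 + length doubles) hit-bound))

    -- `hit` is now as long as the list of all subsets, hence exhausts it; `x` and `y` rule out its
    -- entries `⊥` and `⊤`.
    dichotomy : ∀ S {x y} → x ∈ S → y ∉ S → Member S ⊎ Member (∁ S)
    dichotomy S x∈S y∉S
      with Unique-⊆-length⇒⊇ _≟ˢ_ hit-unique (λ {T} _ → ∈-subsets T)
             (subst (_≤ length hit) (sym (length-subsets (suc m))) hit-full) (∈-subsets S)
    ... | here eq = contradiction eq (∈⇒≢⊥ x∈S)
    ... | there (here eq) = contradiction eq (∉⇒≢⊤ y∉S)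
    ... | there (there S∈) with ∈-hit-tail S∈
    ...   | v , inj₁ eq = inj₁ (v , eq)
    ...   | v , inj₂ eq = inj₂ (v , trans (sym (∁-involutive (M v))) (cong ∁ eq))

    Cosingleton : Fin (suc m) → Set
    Cosingleton j = Member (∁ ⁅ j ⁆)

    cosingleton? : Decidable Cosingleton
    cosingleton? j = member? (∁ ⁅ j ⁆)

    -- At least two points, phrased so as to give a point shared with any `∁ ⁅ j ⁆`.
    Big : Subset (suc m) → Set
    Big S = ∀ j → ∃ λ x → x ∈ S × x ≢ j

    -- A, B and the complements of the points of A ∩ B would meet pairwise without
    -- having a common point.
    no-triple : ∀ {A B x z} → Member A → Member B → x ∈ A → x ∈ B → (z ∈ A → z ∉ B) →
                (∀ {j} → j ∈ A → j ∈ B → Cosingleton j) →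
                (∀ {j} → j ∈ A → j ∈ B → ∃ λ a → a ∈ A × a ≢ j) →
                (∀ {j} → j ∈ A → j ∈ B → ∃ λ b → b ∈ B × b ≢ j) → Absurd
    no-triple {A} {B} {x} {z} (u , refl) (v , refl) x∈A x∈B z∉ cosing bigA bigB
      = case helly P? meet of λ where
          (i , i∈) →
            let i∈A = i∈ u (inj₁ (inj₁ refl))
                i∈B = i∈ v (inj₁ (inj₂ refl))
                w , eq = cosing i∈A i∈B
            in x∈p⇒x∉∁p (x∈⁅x⁆ i) (∈-elim eq (i∈ w (inj₂ (i , (i∈A , i∈B) , eq))))
      where
      Base : Fin n → Set
      Base w = w ≡ u ⊎ w ≡ v

      CoPoint : Fin n → Set
      CoPoint w = ∃ λ j → (j ∈ A × j ∈ B) × M w ≡ ∁ ⁅ j ⁆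

      P : Fin n → Set
      P w = Base w ⊎ CoPoint w

      P? : Decidable P
      P? w = ((w ≟ u) ⊎-dec (w ≟ v)) ⊎-dec
             any? λ j → ((j ∈? A) ×-dec (j ∈? B)) ×-dec (M w ≟ˢ ∁ ⁅ j ⁆)

      x∈base : ∀ {w} → Base w → x ∈ M w
      x∈base (inj₁ refl) = x∈A
      x∈base (inj₂ refl) = x∈B

      base-copoint : ∀ {w w′} → Base w → CoPoint w′ → ∃ λ i → i ∈ M w × i ∈ M w′
      base-copoint (inj₁ refl) (j , (j∈A , j∈B) , eq) with a , a∈ , a≢j ← bigA j∈A j∈B =
        a , a∈ , ∈-elim (sym eq) (≢⇒∈∁⁅⁆ a≢j)
      base-copoint (inj₂ refl) (j , (j∈A , j∈B) , eq) with b , b∈ , b≢j ← bigB j∈A j∈B =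
        b , b∈ , ∈-elim (sym eq) (≢⇒∈∁⁅⁆ b≢j)

      z∈copoint : ∀ {w} → CoPoint w → z ∈ M w
      z∈copoint (j , (j∈A , j∈B) , eq) = ∈-elim (sym eq) (≢⇒∈∁⁅⁆ λ where refl → z∉ j∈A j∈B)

      meet : ∀ w w′ → P w → P w′ → ∃ λ i → i ∈ M w × i ∈ M w′
      meet w w′ (inj₁ b) (inj₁ b′) = x , x∈base b , x∈base b′
      meet w w′ (inj₁ b) (inj₂ c′) = base-copoint b c′
      meet w w′ (inj₂ c) (inj₁ b′) with i , i∈ , i∈′ ← base-copoint b′ c = i , i∈′ , i∈
      meet w w′ (inj₂ c) (inj₂ c′) = z , z∈copoint c , z∈copoint c′

    singleton-or-big : ∀ v → (∃ λ j → M v ≡ ⁅ j ⁆) ⊎ Big (M v)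
    singleton-or-big v with any? (λ j → M v ≟ˢ ⁅ j ⁆)
    ... | yes eq = inj₁ eq
    ... | no ∄j  = inj₂ λ j → case any? (λ x → (x ∈? M v) ×-dec ¬? (x ≟ j)) of λ where
        (yes x∈) → x∈
        (no ∄x)  → contradiction (j , ≡⁅⁆ λ {x} x∈ → decidable-stable (x ≟ j) λ x≢j → ∄x (x , x∈ , x≢j)) ∄j
      where
      ≡⁅⁆ : ∀ {j} → (∀ {x} → x ∈ M v → x ≡ j) → M v ≡ ⁅ j ⁆
      ≡⁅⁆ {j} x≡j = ⊆-antisym
        (λ x∈ → subst (_∈ ⁅ j ⁆) (sym (x≡j x∈)) (x∈⁅x⁆ j))
        (λ x∈ → let i , i∈ = nonempty v in
           subst (_∈ M v) (trans (x≡j i∈) (sym (x∈⁅y⁆⇒x≡y j x∈))) i∈)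

    -- This is `no-triple` with both sets equal to `M v`, and `z` a point that `M v` misses.
    cosingletons-⊉ : ∀ {v} → Big (M v) → ¬ (∀ {j} → j ∈ M v → Cosingleton j)
    cosingletons-⊉ {v} big cosing with x , x∈ ← nonempty v with z , z∉ ← proper v =
      no-triple (v , refl) (v , refl) x∈ x∈ (λ _ → z∉) (λ j∈ _ → cosing j∈) (λ _ _ → big _) (λ _ _ → big _)

    -- A minimal double below `v` must be a singleton: if it were big, removing it with its
    -- complement would cost only two doubles but at least two points, and the bound for the rest
    -- would contradict `doubles-full`.
    double∋cosingleton : ∀ {v} → Double v → ∃ λ l → l ∈ M v × Cosingleton l
    double∋cosingleton {v} dv
      with u , u∈D , u⊆v , u-min ← minimal-below doubles (∈-doubles {v} dv)
      with ū , _ , opp ← doubles-closed u∈D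
      with singleton-or-big u
    ... | inj₁ (l , u≡l) = l , u⊆v (∈-elim (sym u≡l) (x∈⁅x⁆ l)) , ū , trans opp (cong ∁ u≡l)
    ... | inj₂ big
      with a , a∈ ← nonempty u with b , b∈ , b≢a ← big a = contradiction (begin
        2 + suc (length Y)            ≤⟨ s≤s (Unique-⊆⇒length-≤ a∷b∷Y! λ {i} _ → ∈-allFin i) ⟩
        suc (length (allFin (suc m))) ≡⟨ cong suc (length-allFin (suc m)) ⟩
        2 + m                         ≤⟨ s≤s m<1+Y ⟩
        2 + length Y                  ∎) (ℕ.<⇒≱ (ℕ.n<1+n _))
      where
      open ℕ.≤-Reasoning
      open Removal doubles-closed u∈D opp

      Y : List (Fin (suc m))
      Y = filter off? (allFin (suc m))

      a∷b∷Y! : Unique (a ∷ b ∷ Y)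
      a∷b∷Y! = ∉⇒Unique-∷ (λ where (here refl) → b≢a refl
                                   (there a∈Y) → proj₂ (∈-filter⁻ off? {xs = allFin (suc m)} a∈Y) a∈)
              (∉⇒Unique-∷ (λ b∈Y → proj₂ (∈-filter⁻ off? {xs = allFin (suc m)} b∈Y) b∈)
                (Unique.filter⁺ off? (Unique.allFin⁺ (suc m))))

      m<1+Y : suc m ≤ suc (length Y)
      m<1+Y = ℕ.*-cancelˡ-≤ 2 (begin
        2 * suc m               ≤⟨ doubles-full ⟩
        2 + length doubles      ≤⟨ ℕ.+-monoʳ-≤ 2 (length-D≤ doubles-unique) ⟩
        2 + (2 + length D⁻)     ≤⟨ ℕ.+-monoʳ-≤ 2 (2+length≤2*cover D⁻ Y (Unique.filter⁺ kept? doubles-unique)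
                                     D⁻-closed (covers⁻ u-min (allFin-covers doubles))) ⟩
        2 + 2 * length Y        ≡⟨ ℕ.*-suc 2 (length Y) ⟨
        2 * suc (length Y)      ∎)

    mixed? : ∀ v → Decidable λ x → (x ∈ M v × Cosingleton x) ⊎ (x ∉ M v × ¬ Cosingleton x)
    mixed? v x = ((x ∈? M v) ×-dec cosingleton? x) ⊎-dec (¬? (x ∈? M v) ×-dec ¬? (cosingleton? x))

    mixed : Fin n → Subset (suc m)
    mixed v = ⟪ mixed? v ⟫

    -- A point is in `mixed v` when lying in `M v` and being a cosingleton agree; complementing
    -- `M v` turns agreement into disagreement. Both outcomes of `dichotomy` thus reduce to one
    -- argument.
    ∁-mixed : ∀ {v w} → Opposite v w → ∁ (mixed v) ≡ mixed w
    ∁-mixed {v} {w} opp = ⊆-antisym to from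
      where
      to : ∁ (mixed v) ⊆ mixed w
      to {x} x∈ with x ∈? M v | cosingleton? x
      ... | yes x∈v | yes cx = contradiction (∈⟪⟫⁺ (mixed? v) (inj₁ (x∈v , cx))) (x∈∁p⇒x∉p x∈)
      ... | yes x∈v | no ¬cx = ∈⟪⟫⁺ (mixed? w) (inj₂ ((λ x∈w → ∈-opposite⇒∉ opp x∈w x∈v) , ¬cx))
      ... | no x∉v  | yes cx = ∈⟪⟫⁺ (mixed? w) (inj₁ (∉⇒∈-opposite opp x∉v , cx))
      ... | no x∉v  | no ¬cx = contradiction (∈⟪⟫⁺ (mixed? v) (inj₂ (x∉v , ¬cx))) (x∈∁p⇒x∉p x∈)

      from : mixed w ⊆ ∁ (mixed v)
      from {x} x∈w = x∉p⇒x∈∁p λ x∈v → case ∈⟪⟫⁻ (mixed? v) x∈v , ∈⟪⟫⁻ (mixed? w) x∈w of λ where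
        (inj₁ (x∈v , _) , inj₁ (x∈w , _)) → ∈-opposite⇒∉ opp x∈w x∈v
        (inj₁ (_ , cx)  , inj₂ (_ , ¬cx)) → ¬cx cx
        (inj₂ (_ , ¬cx) , inj₁ (_ , cx))  → ¬cx cx
        (inj₂ (x∉v , _) , inj₂ (x∉w , _)) → x∉w (∉⇒∈-opposite opp x∉v)

    ∃noncosingleton : ∀ {v} → Big (M v) → ∃ λ r → r ∈ M v × ¬ Cosingleton r
    ∃noncosingleton {v} big with any? (λ r → (r ∈? M v) ×-dec ¬? (cosingleton? r))
    ... | yes r = r
    ... | no ∄r = contradiction
      (λ {j} j∈ → decidable-stable (cosingleton? j) λ ¬cj → ∄r (j , j∈ , ¬cj)) (cosingletons-⊉ big)

    -- `M v` and `mixed v` share only cosingletons, among them `l`, so `no-triple` applies. The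
    -- point `r` outside `M v` serves both as `z` and as the second point of `mixed v`.
    mixed-∉ : ∀ {v w} → Opposite v w → Big (M v) → Big (M w) → ¬ Member (mixed v)
    mixed-∉ {v} {w} opp big-v big-w mem
      with l , l∈v , cl ← double∋cosingleton (w , opp)
      with r , r∈w , ¬cr ← ∃noncosingleton big-w =
        no-triple (v , refl) mem l∈v (∈⟪⟫⁺ (mixed? v) (inj₁ (l∈v , cl)))
          (λ r∈v → contradiction r∈v (∈-opposite⇒∉ opp r∈w))
          (λ j∈v j∈ → case ∈⟪⟫⁻ (mixed? v) j∈ of λ where
            (inj₁ (_ , cj))  → cj
            (inj₂ (j∉v , _)) → contradiction j∈v j∉v)
          (λ _ _ → big-v _)
          (λ j∈v _ → r , ∈⟪⟫⁺ (mixed? v) (inj₂ (∈-opposite⇒∉ opp r∈w , ¬cr))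
                       , λ where refl → ∈-opposite⇒∉ opp r∈w j∈v)

    opposites-not-big : ∀ {v w} → Opposite v w → Big (M v) → ¬ Big (M w)
    opposites-not-big {v} {w} opp big-v big-w
      with l , l∈v , cl ← double∋cosingleton (w , opp)
      with r , r∈v , ¬cr ← ∃noncosingleton big-v
      with dichotomy (mixed v) (∈⟪⟫⁺ (mixed? v) (inj₁ (l∈v , cl)))
             (λ r∈ → case ∈⟪⟫⁻ (mixed? v) r∈ of λ where
               (inj₁ (_ , cr))  → ¬cr cr
               (inj₂ (r∉v , _)) → r∉v r∈v)
    ... | inj₁ mem = mixed-∉ opp big-v big-w mem
    ... | inj₂ mem = mixed-∉ (opposite-sym opp) big-w big-v (subst Member (∁-mixed opp) mem)

    Isolated : Fin (suc m) → Set
    Isolated j = Member ⁅ j ⁆ × Cosingleton j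

    isolated? : Decidable Isolated
    isolated? j = member? ⁅ j ⁆ ×-dec cosingleton? j

    isolated : List (Fin (suc m))
    isolated = filter isolated? (allFin (suc m))

    double⇒isolated : ∀ {v} → Double v → ∃ λ j → Isolated j × (M v ≡ ⁅ j ⁆ ⊎ M v ≡ ∁ ⁅ j ⁆)
    double⇒isolated {v} (w , opp) with singleton-or-big v | singleton-or-big w
    ... | inj₁ (j , v≡j) | _ = j , ((v , v≡j) , w , trans opp (cong ∁ v≡j)) , inj₁ v≡j
    ... | inj₂ _ | inj₁ (j , w≡j) = j , ((w , w≡j) , v , v≡) , inj₂ v≡
      where v≡ = trans (opposite-sym opp) (cong ∁ w≡j)
    ... | inj₂ big-v | inj₂ big-w = contradiction big-w (opposites-not-big opp big-v)

    -- Every double is `⁅ j ⁆` or `∁ ⁅ j ⁆` for an isolated `j`, so each isolated point yields at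
    -- most two of the `2 * m` doubles.
    m≤isolated : m ≤ length isolated
    m≤isolated = ℕ.≤-pred (ℕ.*-cancelˡ-≤ 2 (begin
      2 * suc m                          ≤⟨ doubles-full ⟩
      2 + length doubles                 ≡⟨ cong (2 +_) (length-map M doubles) ⟨
      2 + length (map M doubles)         ≤⟨ ℕ.+-monoʳ-≤ 2 (Unique-⊆⇒length-≤ (Unique.map⁺ injective doubles-unique) ⊆) ⟩
      2 + length (map ⁅_⁆ isolated ++ map (∁ ∘ ⁅_⁆) isolated)
                                         ≡⟨ cong (2 +_) len ⟩
      2 + 2 * length isolated            ≡⟨ ℕ.*-suc 2 (length isolated) ⟨
      2 * suc (length isolated)          ∎))
      where
      open ℕ.≤-Reasoning
      ⊆ : ∀ {S} → S ∈ˡ map M doubles → S ∈ˡ map ⁅_⁆ isolated ++ map (∁ ∘ ⁅_⁆) isolated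
      ⊆ S∈ with v , v∈ , refl ← ∈-map⁻ M S∈
        with double⇒isolated {v} (proj₂ (∈-filter⁻ double? {xs = allFin n} v∈))
      ... | j , ij , inj₁ eq = ∈-++⁺ˡ
        (subst (_∈ˡ _) (sym eq) (∈-map⁺ ⁅_⁆ (∈-filter⁺ isolated? (∈-allFin j) ij)))
      ... | j , ij , inj₂ eq = ∈-++⁺ʳ (map ⁅_⁆ isolated)
        (subst (_∈ˡ _) (sym eq) (∈-map⁺ (∁ ∘ ⁅_⁆) (∈-filter⁺ isolated? (∈-allFin j) ij)))

      len : length (map ⁅_⁆ isolated ++ map (∁ ∘ ⁅_⁆) isolated) ≡ 2 * length isolated
      len = trans (length-++ (map ⁅_⁆ isolated))
        (trans (cong (_+ length (map (∁ ∘ ⁅_⁆) isolated)) (length-map ⁅_⁆ isolated))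
               (cong (length isolated +_) (trans (length-map (∁ ∘ ⁅_⁆) isolated) (sym (ℕ.+-identityʳ _)))))

    nonisolated-unique : ∀ {i j} → ¬ Isolated i → ¬ Isolated j → i ≡ j
    nonisolated-unique {i} {j} ¬i ¬j = decidable-stable (i ≟ j) λ i≢j → contradiction (begin
      2 + m                    ≤⟨ ℕ.+-monoʳ-≤ 2 m≤isolated ⟩
      2 + length isolated      ≤⟨ Unique-⊆⇒length-≤ (i∷j∷! i≢j) (λ {x} _ → ∈-allFin x) ⟩
      length (allFin (suc m))  ≡⟨ length-allFin (suc m) ⟩
      suc m                    ∎) (ℕ.<⇒≱ (ℕ.n<1+n _))
      where
      open ℕ.≤-Reasoning
      ∉isolated : ∀ {x} → ¬ Isolated x → x ∉ˡ isolated
      ∉isolated ¬x x∈ = ¬x (proj₂ (∈-filter⁻ isolated? {xs = allFin (suc m)} x∈))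

      i∷j∷! : i ≢ j → Unique (i ∷ j ∷ isolated)
      i∷j∷! i≢j = ∉⇒Unique-∷ (λ where (here refl) → i≢j refl
                                      (there i∈)  → ∉isolated ¬i i∈)
                 (∉⇒Unique-∷ (∉isolated ¬j) (Unique.filter⁺ isolated? (Unique.allFin⁺ (suc m))))

    ∃center : ∃ λ c → ∀ {i} → i ≢ c → Isolated i
    ∃center with all? isolated?
    -- When all points are isolated any centre will do; `zero` is an arbitrary choice.
    ... | yes iso = zero , λ {i} _ → iso i
    ... | no ¬iso with c , ¬c ← ¬∀⟶∃¬ (suc m) Isolated isolated? ¬iso =
      c , λ {i} i≢c → decidable-stable (isolated? i) λ ¬i → i≢c (nonisolated-unique ¬i ¬c)

    starShaped : ∃ StarShaped
    starShaped with c , iso ← ∃center = c , record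
      { leaf = proj₁ ∘ iso ; through = through ; avoiding = avoiding }
      where
      avoiding : ∀ {v} → c ∉ M v → ∃ λ i → i ≢ c × M v ≡ ⁅ i ⁆
      avoiding {v} c∉v with singleton-or-big v
      ... | inj₁ (i , eq) = i , (λ where refl → c∉v (∈-elim (sym eq) (x∈⁅x⁆ i))) , eq
      ... | inj₂ big = contradiction (λ {j} j∈v → proj₂ (iso {j} λ where refl → c∉v j∈v)) (cosingletons-⊉ big)

      through : ∀ {S z} → c ∈ S → z ∉ S → Member S
      through {S} c∈S z∉S with dichotomy S c∈S z∉S
      ... | inj₁ mem = mem
      -- If `∁ S` is the member, it avoids `c` and so is some `⁅ i ⁆` with `i` isolated; then its
      -- complement `S` is a member as well.
      ... | inj₂ (v , eq) with i , i≢c , eq′ ← avoiding {v} (x∈p⇒x∉∁p c∈S ∘ ∈-elim eq) =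
        subst Member (trans (cong ∁ (trans (sym eq′) eq)) (∁-involutive S)) (proj₂ (iso i≢c))

-- The isomorphism with the extremal graph.

module StarIsomorphism {n m : ℕ} {M : Fin n → Subset (suc m)} (hf : HellyFamily M)
                       {c : Fin (suc m)} (star : HellyFamilyProperties.StarShaped hf c) where
  open HellyFamily hf
  open HellyFamilyProperties hf using (module StarShaped)
  open StarShaped star

  -- The vertex of the extremal graph for S corresponds to a set containing
  -- the centre c and missing exactly the clique vertices adjacent to it.
  N : ExtremalVertex m → Subset (suc m)
  N (inj₁ j) = ⁅ punchIn c j ⁆
  N (inj₂ S) = insertAt (∁ (value S)) c inside

  c∈insertAt : ∀ T → c ∈ insertAt T c inside
  c∈insertAt T = lookup⇒[]= c _ (insertAt-lookup T c inside)

  punchIn∈⁺ : ∀ {T j} → j ∈ T → punchIn c j ∈ insertAt T c inside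
  punchIn∈⁺ {T} {j} j∈T = lookup⇒[]= _ _ (trans (insertAt-punchIn T c inside j) ([]=⇒lookup j∈T))

  punchIn∈⁻ : ∀ {T j} → punchIn c j ∈ insertAt T c inside → j ∈ T
  punchIn∈⁻ {T} {j} j∈ = lookup⇒[]= _ _ (trans (sym (insertAt-punchIn T c inside j)) ([]=⇒lookup j∈))

  c∉N₁ : ∀ j → c ∉ N (inj₁ j)
  c∉N₁ j c∈ = punchInᵢ≢i c j (sym (x∈⁅y⁆⇒x≡y _ c∈))

  N-injective : ∀ {x y} → N x ≡ N y → x ≡ y
  N-injective {inj₁ i} {inj₁ j} eq = cong inj₁ (punchIn-injective c i j (⁅⁆-injective eq))
  N-injective {inj₁ i} {inj₂ S} eq = contradiction (∈-elim (sym eq) (c∈insertAt _)) (c∉N₁ i)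
  N-injective {inj₂ S} {inj₁ j} eq = contradiction (∈-elim eq (c∈insertAt _)) (c∉N₁ j)
  N-injective {inj₂ S} {inj₂ T} eq = cong inj₂ (value-injective (∁-injective
    (trans (sym (removeAt-insertAt (∁ (value S)) c inside))
           (trans (cong (λ U → removeAt U c) eq) (removeAt-insertAt (∁ (value T)) c inside)))))

  Meet : Subset (suc m) → Subset (suc m) → Set
  Meet S T = ∃ λ i → i ∈ S × i ∈ T

  N-adjacency : ∀ x y → Graph._~_ (extremal m) x y ⇔ (¬ Meet (N x) (N y))
  N-adjacency (inj₁ i) (inj₁ j) = mk⇔
    (λ i≢j (x , x∈i , x∈j) →
       i≢j (punchIn-injective c i j (trans (sym (x∈⁅y⁆⇒x≡y _ x∈i)) (x∈⁅y⁆⇒x≡y _ x∈j))))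
    (λ { ∄x refl → ∄x (_ , x∈⁅x⁆ _ , x∈⁅x⁆ _) })
  N-adjacency (inj₁ i) (inj₂ S) = mk⇔
    (λ i∈S (x , x∈i , x∈S) →
       x∈p⇒x∉∁p i∈S (punchIn∈⁻ (subst (_∈ N (inj₂ S)) (x∈⁅y⁆⇒x≡y _ x∈i) x∈S)))
    (λ ∄x → decidable-stable (i ∈? value S) λ i∉S → ∄x (_ , x∈⁅x⁆ _ , punchIn∈⁺ (x∉p⇒x∈∁p i∉S)))
  N-adjacency (inj₂ S) (inj₁ j) = mk⇔
    (λ j∈S (x , x∈S , x∈j) →
       x∈p⇒x∉∁p j∈S (punchIn∈⁻ (subst (_∈ N (inj₂ S)) (x∈⁅y⁆⇒x≡y _ x∈j) x∈S)))
    (λ ∄x → decidable-stable (j ∈? value S) λ j∉S → ∄x (_ , punchIn∈⁺ (x∉p⇒x∈∁p j∉S) , x∈⁅x⁆ _))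
  N-adjacency (inj₂ S) (inj₂ T) = mk⇔ (λ ()) (λ ∄x → ∄x (c , c∈insertAt _ , c∈insertAt _))

  realise : ∀ x → ∃ λ v → M v ≡ N x
  realise (inj₁ j) = leaf (punchInᵢ≢i c j)
  -- The irrelevant proof of non-emptiness is recovered by deciding it; `punchIn c j` then witnesses
  -- that the set is proper.
  realise (inj₂ (S ! [ ne ])) with j , j∈S ← recompute (nonempty? S) ne =
    through (c∈insertAt (∁ S)) (x∈p⇒x∉∁p j∈S ∘ punchIn∈⁻)

  classify : ∀ v → ∃ λ x → N x ≡ M v
  classify v with c ∈? M v
  ... | no c∉v with i , i≢c , eq ← avoiding {v} c∉v =
    inj₁ (punchOut (i≢c ∘ sym)) , trans (cong ⁅_⁆ (punchIn-punchOut (i≢c ∘ sym))) (sym eq)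
  ... | yes c∈v with z , z∉v ← proper v =
    -- `T` is `M v` with the coordinate `c` dropped; its complement is non-empty because `M v`
    -- misses `z`, which differs from `c`.
    inj₂ (∁ T ! [ punchOut c≢z , x∉p⇒x∈∁p z∉T ]) , (begin
      insertAt (∁ (∁ T)) c inside       ≡⟨ cong (λ U → insertAt U c inside) (∁-involutive T) ⟩
      insertAt T c inside               ≡⟨ cong (insertAt T c) ([]=⇒lookup c∈v) ⟨
      insertAt T c (lookup (M v) c)     ≡⟨ insertAt-removeAt (M v) c ⟩
      M v                               ∎)
    where
    open ≡-Reasoning
    T : Subset m
    T = removeAt (M v) c

    c≢z : c ≢ z
    c≢z refl = z∉v c∈v

    z∉T : punchOut c≢z ∉ T
    z∉T z∈T = z∉v (lookup⇒[]= z _ (trans (sym (removeAt-punchOut (M v) c≢z)) ([]=⇒lookup z∈T)))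

  isomorphism : (G : Graph (Fin n)) → (∀ u v → Graph._~_ G u v ⇔ (¬ Meet (M u) (M v))) →
                G ≅ extremal m
  isomorphism G adj = record
    { bijection = mk↔ₛ′ to from
        (λ x → N-injective (trans (proj₂ (classify (from x))) (proj₂ (realise x))))
        (λ v → injective (trans (proj₂ (realise (to v))) (proj₂ (classify v))))
    ; adjacency = λ u v → mk⇔
        (λ u~v → Equivalence.from (N-adjacency (to u) (to v)) λ (i , i∈u , i∈v) →
           Equivalence.to (adj u v) u~v
             (i , ∈-elim (proj₂ (classify u)) i∈u , ∈-elim (proj₂ (classify v)) i∈v))
        (λ u~v → Equivalence.from (adj u v) λ (i , i∈u , i∈v) →
           Equivalence.to (N-adjacency (to u) (to v)) u~v
             (i , ∈-elim (sym (proj₂ (classify u))) i∈u , ∈-elim (sym (proj₂ (classify v))) i∈v))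
    }
    where
    to : Fin n → ExtremalVertex m
    to = proj₁ ∘ classify

    from : ExtremalVertex m → Fin n
    from = proj₁ ∘ realise

-- The Helly family of maximal independent sets.

module MaximalIndependentSets {n : ℕ} (G : Graph (Fin n)) where
  open Graph G

  maximalSets : List (Subset n)
  maximalSets = filter (maximalIndependent? G) (subsets n)

  maximalSet : Fin (i-max G) → Subset n
  maximalSet = List.lookup maximalSets

  maximalSet-independent : ∀ i → Independent G (maximalSet i)
  maximalSet-independent i =
    proj₁ (proj₂ (∈-filter⁻ (maximalIndependent? G) {xs = subsets n} (∈-lookup {xs = maximalSets} i)))

  extend : ∀ {S} → Independent G S → ∃ λ i → S ⊆ maximalSet i
  extend {S} indS = go S indS (⊃-wellFounded S)
    where
    go : ∀ S → Independent G S → Acc _⊃_ S → ∃ λ i → S ⊆ maximalSet i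
    go S indS (acc rec) with anySubset? (λ T → (S ⊂? T) ×-dec independent? G T)
    ... | yes (T , S⊂T , indT) with i , T⊆ ← go T indT (rec S⊂T) = i , T⊆ ∘ proj₁ S⊂T
    ... | no ∄T = Any.index S∈ , ∈-elim (lookup-index S∈)
      where
      S∈ : S ∈ˡ maximalSets
      S∈ = ∈-filter⁺ (maximalIndependent? G) (∈-subsets S) (indS , ∄T)

  memberships : Fin n → Subset (i-max G)
  memberships v = ⟪ (λ i → v ∈? maximalSet i) ⟫

  ∈-memberships⁺ : ∀ {v i} → v ∈ maximalSet i → i ∈ memberships v
  ∈-memberships⁺ {v} = ∈⟪⟫⁺ (λ i → v ∈? maximalSet i)

  ∈-memberships⁻ : ∀ {v i} → i ∈ memberships v → v ∈ maximalSet i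
  ∈-memberships⁻ {v} = ∈⟪⟫⁻ (λ i → v ∈? maximalSet i)

  -- The source of the Helly property: the independent set `⟪ P? ⟫` extends to a maximal one, whose
  -- index is the common point.
  common : ∀ {P : Fin n → Set} → Decidable P → (∀ u v → P u → P v → ¬ u ~ v) →
           ∃ λ i → ∀ v → P v → i ∈ memberships v
  common P? ind
    with i , ⊆i ← extend {⟪ P? ⟫} (λ u v u∈ v∈ → ind u v (∈⟪⟫⁻ P? u∈) (∈⟪⟫⁻ P? v∈)) =
      i , λ v pv → ∈-memberships⁺ (⊆i (∈⟪⟫⁺ P? pv))

  -- If `u` and `v` are not adjacent, `common` applied to the pair gives a maximal independent set
  -- containing both.
  adjacent⇔disjoint : ∀ u v → u ~ v ⇔ (¬ ∃ λ i → i ∈ memberships u × i ∈ memberships v)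
  adjacent⇔disjoint u v = mk⇔
    (λ u~v (i , i∈u , i∈v) → maximalSet-independent i u v (∈-memberships⁻ i∈u) (∈-memberships⁻ i∈v) u~v)
    (λ ∄i → decidable-stable (u ~? v) λ u≁v →
       let i , i∈ = common (λ w → (w ≟ u) ⊎-dec (w ≟ v)) (independent-pair u≁v)
       in ∄i (i , i∈ u (inj₁ refl) , i∈ v (inj₂ refl)))
    where
    independent-pair : ¬ u ~ v → ∀ x y → x ≡ u ⊎ x ≡ v → y ≡ u ⊎ y ≡ v → ¬ x ~ y
    independent-pair u≁v x y (inj₁ refl) (inj₁ refl) = ~-irrefl
    independent-pair u≁v x y (inj₁ refl) (inj₂ refl) = u≁v
    independent-pair u≁v x y (inj₂ refl) (inj₁ refl) = u≁v ∘ ~-sym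
    independent-pair u≁v x y (inj₂ refl) (inj₂ refl) = ~-irrefl

  nonempty-memberships : ∀ v → Nonempty (memberships v)
  nonempty-memberships v with i , i∈ ← common (_≟ v) (λ where _ _ refl refl → ~-irrefl) = i , i∈ v refl

-- Of the two subsets the empty one is not maximal. This excludes the one-vertex graph, whose vertex
-- has no neighbour.
i-max-Fin1 : (G : Graph (Fin 1)) → i-max G < 2
i-max-Fin1 G = filter-notAll (maximalIndependent? G) (subsets 1) (there (here ∅-not-maximal))
  where
  ∅-not-maximal : ¬ MaximalIndependent G (outside ∷ [])
  ∅-not-maximal (_ , ∄T) = ∄T (inside ∷ [] , out⊂in (λ ()) , λ where
    zero zero _ _ → Graph.~-irrefl G)

another-vertex : ∀ {n} (G : Graph (Fin n)) → 2 ≤ i-max G → (v : Fin n) → ∃ λ u → v ≢ u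
another-vertex {suc zero}    G 2≤k _ = contradiction (i-max-Fin1 G) (ℕ.≤⇒≯ 2≤k)
another-vertex {suc (suc _)} G 2≤k v = punchIn v zero , punchInᵢ≢i v zero ∘ sym

hellyFamily : ∀ {n} (G : Graph (Fin n)) → Connected G → TwinFree G → 2 ≤ i-max G →
              HellyFamily (MaximalIndependentSets.memberships G)
hellyFamily {n} G connected twinFree 2≤k = record
  { injective = λ {u} {v} eq → decidable-stable (u ≟ v) λ u≢v → twinFree u v u≢v λ w →
      mk⇔ (same-neighbours eq) (same-neighbours (sym eq))
  ; nonempty = nonempty-memberships
  ; proper = proper
  ; helly = λ P? meet → common P? λ u v pu pv u~v → Equivalence.to (adjacent⇔disjoint u v) u~v (meet u v pu pv)
  }
  where
  open Graph G
  open MaximalIndependentSets G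

  same-neighbours : ∀ {u v w} → memberships u ≡ memberships v → u ~ w → v ~ w
  same-neighbours {u} {v} {w} eq u~w = Equivalence.from (adjacent⇔disjoint v w) λ (i , i∈v , i∈w) →
    Equivalence.to (adjacent⇔disjoint u w) u~w (i , ∈-elim (sym eq) i∈v , i∈w)

  neighbour : ∀ {u v} → u ≢ v → Star _~_ u v → ∃ λ w → u ~ w
  neighbour u≢v ε         = contradiction refl u≢v
  neighbour u≢v (u~w ◅ _) = _ , u~w

  -- By connectivity `v` has a neighbour `w`, and a maximal independent set through `w` misses `v`.
  proper : ∀ v → ∃ λ i → i ∉ memberships v
  proper v
    with u , v≢u ← another-vertex G 2≤k v
    with w , v~w ← neighbour v≢u (connected v u)
    with i , i∈w ← nonempty-memberships w =
      i , λ i∈v → Equivalence.to (adjacent⇔disjoint v w) v~w (i , i∈v , i∈w)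

-- From the set family back to the graph.

module _ {n k : ℕ} {M : Fin n → Subset k} (hf : HellyFamily M) (G : Graph (Fin n))
         (adj : ∀ u v → Graph._~_ G u v ⇔ (¬ ∃ λ i → i ∈ M u × i ∈ M v)) where

  bound-and-extremality : 2 ≤ k →
    (n ≤ (2 ^ (k ∸ 1) + k) ∸ 2) × (n ≡ (2 ^ (k ∸ 1) + k) ∸ 2 → G ≅ extremal (k ∸ 1))
  bound-and-extremality (s≤s {n = m} 1≤m) =
    ℕ.m+n≤o⇒m≤o∸n n n+2≤ , λ n≡ →
      StarIsomorphism.isomorphism hf (proj₂ (Extremal.starShaped
        -- Truncated subtraction can be undone here, since `2 ≤ suc m ≤ 2 ^ m + suc m`.
        (trans (cong (_+ 2) n≡) (ℕ.m∸n+n≡m (ℕ.≤-trans (s≤s 1≤m) (ℕ.m≤n+m (suc m) (2 ^ m))))))) G adj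
    where open HellyFamilyProperties hf

theorem1p2 : ∀ (k : ℕ) → 2 ≤ k →
    ∀ (n : ℕ) (G : Graph (Fin n)) →
    Connected G → TwinFree G → i-max G ≡ k →
    (n ≤ (2 ^ (k ∸ 1) + k) ∸ 2)
    × (n ≡ (2 ^ (k ∸ 1) + k) ∸ 2 → G ≅ extremal (k ∸ 1))
theorem1p2 k 2≤k n G connected twinFree refl =
  bound-and-extremality (hellyFamily G connected twinFree 2≤k) G
    (MaximalIndependentSets.adjacent⇔disjoint G) 2≤k
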